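{- Let $\mathcal{F}=(W,\preceq,\mathcal{V})$ be a finite poset model and $w_1,w_2\in W$. Then $w_1\equiv_\eta w_2$ if and only if $w_1\approx_\pm w_2$.
   Context: Fix a set PL of proposition letters. A poset model is $\mathcal{F}=(W,\preceq,\mathcal{V})$ with $(W,\preceq)$ a partial order and $\mathcal{V}:\mathrm{PL}\to\mathcal{P}(W)$. $[m;n]=\{i\in\mathbb{N}:m\le i\le n\}$, $[m;n)=\{i:m\le i<n\}$. An undirected path of length $\ell$ from $w$ is $\pi:[0;\ell]\to W$ with $\pi(0)=w$ and, for each $i\in[0;\ell)$, $\pi(i)\preceq\pi(i+1)$ or $\pi(i+1)\preceq\pi(i)$. A $\downarrow$-path is an undirected path of length $\ell\ge1$ with $\pi(\ell)\preceq\pi(\ell-1)$. A $\pm$-path is a $\downarrow$-path of length $\ell\ge2$ with $\pi(0)\preceq\pi(1)$. SLCS$_\eta$ formulas: $\Phi::=p\mid\neg\Phi\mid\Phi_1\wedge\Phi_2\mid\eta(\Phi_1,\Phi_2)$; $w\models p$ iff $w\in\mathcal{V}(p)$; negation, conjunction standard; $w\models\eta(\Phi_1,\Phi_2)$ iff some $\pm$-path $\pi:[0;\ell]\to W$ from $w$ has $\pi(\ell)\models\Phi_2$ and $\pi(i)\models\Phi_1$ for all $i\in[0;\ell)$. $w_1\equiv_\eta w_2$ means $w_1,w_2$ satisfy the same SLCS$_\eta$ formulas. A weak $\pm$-bisimulation is a symmetric relation $B\subseteq W\times W$ such that whenever $B(w_1,w_2)$: (1) for every $p$, $w_1\in\mathcal{V}(p)$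 iff $w_2\in\mathcal{V}(p)$; (2) for all $u_1,d_1\in W$ with ($w_1\preceq u_1$ or $u_1\preceq w_1$) and $d_1\preceq u_1$, there is a $\pm$-path $\pi_2:[0;\ell_2]\to W$ from $w_2$ with $B(d_1,\pi_2(\ell_2))$ and, for all $j\in[0;\ell_2)$, $B(w_1,\pi_2(j))$ or $B(u_1,\pi_2(j))$. $w_1\approx_\pm w_2$ iff some weak $\pm$-bisimulation contains $(w_1,w_2)$. -}

module Defs where

open import Level using (0ℓ) renaming (suc to lsuc)
open import Data.Nat.Base using (ℕ; suc; _+_)
open import Data.Fin.Base using (Fin; zero; suc; inject₁; fromℕ)
open import Data.Product.Base using (Σ; ∃; _×_)
open import Data.Sum.Base using (_⊎_)
open import Function.Bundles using (_⇔_; _↔_)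
open import Relation.Nullary.Negation.Core using (¬_)
open import Relation.Unary using (Pred; _∈_)
open import Relation.Binary.Core using (Rel)
open import Relation.Binary.Definitions using (Symmetric)
open import Relation.Binary.Structures using (IsPartialOrder)
open import Relation.Binary.PropositionalEquality.Core using (_≡_)

record PosetModel (PL : Set) : Set₁ where
  infix 4 _≼_
  field
    W              : Set
    _≼_            : Rel W 0ℓ
    isPartialOrder : IsPartialOrder _≡_ _≼_
    V              : PL → Pred W 0ℓ

Finite : Set → Set
Finite A = ∃ λ n → A ↔ Fin n

data Formula (PL : Set) : Set where
  atom : PL → Formula PL
  neg  : Formula PL → Formula PL
  _∧_  : Formula PL → Formula PL → Formula PL
  η    : Formula PL → Formula PL → Formula PL

module _ {PL : Set} (F : PosetModel PL) where
  open PosetModel F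

  -- A path of length ℓ is a function on [0;ℓ], that is, on Fin (suc ℓ).
  -- For i : Fin ℓ, i.e. i ∈ [0;ℓ), the points π(i) and π(i+1) are
  -- π (inject₁ i) and π (suc i); the endpoint π(ℓ) is π (fromℕ ℓ).
  record IsUndirectedPath (ℓ : ℕ) (w : W) (π : Fin (suc ℓ) → W) : Set where
    field
      start : π zero ≡ w
      step  : ∀ (i : Fin ℓ) →
              π (inject₁ i) ≼ π (suc i) ⊎ π (suc i) ≼ π (inject₁ i)

  -- The length is suc k, which builds in the requirement ℓ ≥ 1.
  record IsDownPath (k : ℕ) (w : W) (π : Fin (2 + k) → W) : Set where
    field
      isUndirectedPath : IsUndirectedPath (suc k) w π
      lastDown         : π (fromℕ (suc k)) ≼ π (inject₁ (fromℕ k))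

  -- The length is 2 + k, which builds in the requirement ℓ ≥ 2.
  record IsPMPath (k : ℕ) (w : W) (π : Fin (3 + k) → W) : Set where
    field
      isDownPath : IsDownPath (suc k) w π
      firstUp    : π zero ≼ π (suc zero)

  Sat : W → Formula PL → Set
  Sat w (atom p) = w ∈ V p
  Sat w (neg Φ)  = ¬ Sat w Φ
  Sat w (Φ ∧ Ψ)  = Sat w Φ × Sat w Ψ
  Sat w (η Φ Ψ)  =
    Σ ℕ λ k → Σ (Fin (3 + k) → W) λ π →
      IsPMPath k w π
      × Sat (π (fromℕ (2 + k))) Ψ
      × (∀ (i : Fin (2 + k)) → Sat (π (inject₁ i)) Φ)

  ηEquivalent : Rel W 0ℓ
  ηEquivalent w₁ w₂ = ∀ (Φ : Formula PL) → Sat w₁ Φ ⇔ Sat w₂ Φ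

  record IsWeakPMBisimulation (B : Rel W 0ℓ) : Set where
    field
      symmetric : Symmetric B
      atoms     : ∀ {w₁ w₂} → B w₁ w₂ → ∀ (p : PL) → w₁ ∈ V p ⇔ w₂ ∈ V p
      transfer  : ∀ {w₁ w₂} → B w₁ w₂ →
                  ∀ (u₁ d₁ : W) → w₁ ≼ u₁ ⊎ u₁ ≼ w₁ → d₁ ≼ u₁ →
                  Σ ℕ λ k → Σ (Fin (3 + k) → W) λ π₂ →
                    IsPMPath k w₂ π₂
                    × B d₁ (π₂ (fromℕ (2 + k)))
                    × (∀ (j : Fin (2 + k)) →
                        B w₁ (π₂ (inject₁ j)) ⊎ B u₁ (π₂ (inject₁ j)))

  WeaklyPMBisimilar : Rel W (lsuc 0ℓ)
  WeaklyPMBisimilar w₁ w₂ = Σ (Rel W 0ℓ) λ B → IsWeakPMBisimulation B × B w₁ w₂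

{-# OPTIONS --safe #-}
module Submission where

open import Defs
open import Level using (0ℓ)
open import Axiom.ExcludedMiddle using (ExcludedMiddle)
open import Axiom.DoubleNegationElimination using (DoubleNegationElimination; em⇒dne)
open import Data.Empty using (⊥-elim)
open import Data.Fin.Base using (Fin; zero; suc; inject₁; fromℕ)
open import Data.Nat.Base using (ℕ; zero; suc; _+_)
open import Data.Product using (Σ; ∃; _×_; _,_; proj₁; proj₂)
open import Data.Sum using (_⊎_; inj₁; inj₂; [_,_]′; map)
open import Data.Vec.Functional using ([]; _∷_)
open import Function.Base using (_∘_)
open import Function.Bundles using (_⇔_; mk⇔; Equivalence; Inverse)
open import Function.Construct.Symmetry using (⇔-sym)
open import Relation.Binary.Core using (Rel)
open import Relation.Binary.PropositionalEquality using (refl; subst)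
open import Relation.Binary.Structures using (IsPartialOrder)
open import Relation.Nullary using (¬_; yes; no)
open import Relation.Unary using (Pred; _⊆_; _∪_)

open Equivalence using (to; from)

-- From right to left, every step x, x′ of a path is matched through (2) with
-- u₁ = d₁ = x′ and the last, downward step x, d with u₁ = x and d₁ = d; the
-- resulting ±-paths concatenate to a ±-path.  From left to right, ηEquivalent
-- is itself a weak ±-bisimulation: as W is finite, the class of each point x
-- is defined by a formula χ x, so w₁ satisfies η (χ w₁ ∨ χ u₁) (χ d₁) because
-- of the ±-path w₁, w₁, u₁, d₁, and hence so does w₂.

module _ {PL : Set} (F : PosetModel PL) where
  open PosetModel F
  open IsPartialOrder isPartialOrder using () renaming (refl to ≼-refl)

  -- Paths as inductive chains.

  Comparable : Rel W 0ℓ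
  Comparable x y = x ≼ y ⊎ y ≼ x

  ⟦_⟧ : Formula PL → Pred W 0ℓ
  ⟦ Φ ⟧ w = Sat F w Φ

  -- Unfolds to the truth condition of `η Φ Ψ` for `P = ⟦ Φ ⟧` and `Q = ⟦ Ψ ⟧`, and to the answer
  -- demanded by clause (2) for `P = B w₁ ∪ B u₁` and `Q = B d₁`, so the conversions to and from
  -- chains serve both.
  PMReach : Pred W 0ℓ → Pred W 0ℓ → Pred W 0ℓ
  PMReach P Q w =
    Σ ℕ λ k → Σ (Fin (3 + k) → W) λ π →
      IsPMPath F k w π
      × Q (π (fromℕ (2 + k)))
      × (∀ (i : Fin (2 + k)) → P (π (inject₁ i)))

  -- Inductive form of a ↓-path, on which concatenation and transfer are structural recursions free
  -- of `Fin` arithmetic.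
  data DownChain (P Q : Pred W 0ℓ) : Pred W 0ℓ where
    last : ∀ {x d} → P x → d ≼ x → Q d → DownChain P Q x
    step : ∀ {x y} → P x → Comparable x y → DownChain P Q y → DownChain P Q x

  PMChain : Pred W 0ℓ → Pred W 0ℓ → Pred W 0ℓ
  PMChain P Q w = P w × ∃ λ u → w ≼ u × DownChain P Q u

  module _ {P Q : Pred W 0ℓ} where

    path⇒downChain : ∀ k {x} (π : Fin (2 + k) → W) → IsDownPath F k x π →
                     Q (π (fromℕ (suc k))) →
                     (∀ i → P (π (inject₁ i))) → DownChain P Q x
    path⇒downChain k π record
      { isUndirectedPath = record { start = refl ; step = steps } ; lastDown = down } =
      go k π steps down
      where
      go : ∀ k (π : Fin (2 + k) → W) →
           (∀ i → Comparable (π (inject₁ i)) (π (suc i))) →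
           π (fromℕ (suc k)) ≼ π (inject₁ (fromℕ k)) →
           Q (π (fromℕ (suc k))) →
           (∀ i → P (π (inject₁ i))) → DownChain P Q (π zero)
      go zero    π steps down q ps = last (ps zero) down q
      go (suc k) π steps down q ps =
        step (ps zero) (steps zero) (go k (π ∘ suc) (steps ∘ suc) down q (ps ∘ suc))

    reach⇒chain : PMReach P Q ⊆ PMChain P Q
    reach⇒chain (k , π , record
      { isDownPath = record
        { isUndirectedPath = record { start = refl ; step = steps } ; lastDown = down }
      ; firstUp = up } , q , ps) =
      ps zero , π (suc zero) , up , path⇒downChain k (π ∘ suc)
        (record { isUndirectedPath = record { start = refl ; step = steps ∘ suc }
                ; lastDown = down })
        q (ps ∘ suc)

    isDownPath-∷ : ∀ {k x y π} → Comparable x y →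
                   IsDownPath F k y π → IsDownPath F (suc k) x (x ∷ π)
    isDownPath-∷ c record
      { isUndirectedPath = record { start = refl ; step = steps } ; lastDown = down } =
      record
        { isUndirectedPath = record
          { start = refl
          ; step  = λ { zero → c ; (suc i) → steps i } }
        ; lastDown = down }

    downChain⇒path : ∀ {x} → DownChain P Q x →
                     Σ ℕ λ k → Σ (Fin (2 + k) → W) λ π →
                       IsDownPath F k x π
                       × Q (π (fromℕ (suc k)))
                       × (∀ i → P (π (inject₁ i)))
    downChain⇒path (last {x} {d} p d≼x q) =
      0 , x ∷ d ∷ [] ,
      record { isUndirectedPath = record { start = refl ; step = λ { zero → inj₂ d≼x } }
             ; lastDown = d≼x } ,
      q , λ { zero → p }
    downChain⇒path (step {x} p c chain) with downChain⇒path chain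
    ... | k , π , isPath , q , ps =
      suc k , x ∷ π , isDownPath-∷ c isPath , q , λ { zero → p ; (suc i) → ps i }

    chain⇒reach : PMChain P Q ⊆ PMReach P Q
    chain⇒reach {w} (p , u , w≼u , chain) with downChain⇒path chain
    ... | k , π , isPath , q , ps
      -- Identifies the head of `π` with `u`, so that `w≼u` is the first step of `w ∷ π`.
      with refl ← IsUndirectedPath.start (IsDownPath.isUndirectedPath isPath) =
      k , w ∷ π ,
      record { isDownPath = isDownPath-∷ (inj₁ w≼u) isPath ; firstUp = w≼u } ,
      q , λ { zero → p ; (suc i) → ps i }

    headDown : DownChain P Q ⊆ P
    headDown (last p _ _) = p
    headDown (step p _ _) = p

    PMChain⊆DownChain : PMChain P Q ⊆ DownChain P Q
    PMChain⊆DownChain (p , _ , w≼u , chain) = step p (inj₁ w≼u) chain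

  downChain-map : ∀ {P P′ Q Q′} → P ⊆ P′ → Q ⊆ Q′ → DownChain P Q ⊆ DownChain P′ Q′
  downChain-map f g (last p d≼x q)   = last (f p) d≼x (g q)
  downChain-map f g (step p c chain) = step (f p) c (downChain-map f g chain)

  -- Concatenation: the final downward step becomes an interior one, and the junction point lies in
  -- `P` as the head of the appended chain.
  downChain-bind : ∀ {P Q R} → Q ⊆ DownChain P R → DownChain P Q ⊆ DownChain P R
  downChain-bind f (last p d≼x q)   = step p (inj₂ d≼x) (f q)
  downChain-bind f (step p c chain) = step p c (downChain-bind f chain)

  PMChain-map : ∀ {P P′ Q Q′} → P ⊆ P′ → Q ⊆ Q′ → PMChain P Q ⊆ PMChain P′ Q′
  PMChain-map f g (p , u , w≼u , chain) = f p , u , w≼u , downChain-map f g chain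

  PMChain-bind : ∀ {P Q R} → Q ⊆ DownChain P R → PMChain P Q ⊆ PMChain P R
  PMChain-bind f (p , u , w≼u , chain) = p , u , w≼u , downChain-bind f chain

  -- Invariance of formulas under weak ±-bisimulations.

  module _ {B : Rel W 0ℓ} (isBisim : IsWeakPMBisimulation F B) where
    open IsWeakPMBisimulation isBisim

    transferChain : ∀ {x y u d} {P Q : Pred W 0ℓ} → B x y → Comparable x u → d ≼ u →
                    B x ⊆ P → B u ⊆ P → B d ⊆ Q → PMChain P Q y
    transferChain {x} {u = u} {d} b x~u d≼u f g h =
      PMChain-map {P = B x ∪ B u} [ f , g ]′ h (reach⇒chain (transfer b u d x~u d≼u))

    module _ {P Q : Pred W 0ℓ}
             (P-resp : ∀ {x y} → B x y → P x → P y)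
             (Q-resp : ∀ {x y} → B x y → Q x → Q y) where

      -- Clause (2) answers a step in either direction with a ±-path, so any chain at `x` yields one
      -- at `y` that starts upward. Recursive answers are appended as plain chains.
      downChain-transfer : ∀ {x y} → B x y → DownChain P Q x → PMChain P Q y
      downChain-transfer b (last p d≼x q) =
        transferChain b (inj₁ ≼-refl) d≼x
          (λ b′ → P-resp b′ p) (λ b′ → P-resp b′ p) (λ b′ → Q-resp b′ q)
      downChain-transfer b (step p x~x′ chain) =
        PMChain-bind (λ b′ → PMChain⊆DownChain (downChain-transfer b′ chain))
          (transferChain b x~x′ ≼-refl
            (λ b′ → P-resp b′ p) (λ b′ → P-resp b′ (headDown chain)) (λ b′ → b′))

    -- Induction on `Φ` over all related pairs at once: negation uses the reversed pair, and `η`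
    -- uses invariance of both subformulas along the whole path.
    sat-resp : ∀ Φ {x y} → B x y → Sat F x Φ → Sat F y Φ
    sat-resp (atom p) b s        = to (atoms b p) s
    sat-resp (neg Φ)  b ¬s       = ¬s ∘ sat-resp Φ (symmetric b)
    sat-resp (Φ ∧ Ψ)  b (s , t)  = sat-resp Φ b s , sat-resp Ψ b t
    sat-resp (η Φ Ψ)  b s        =
      chain⇒reach (downChain-transfer (sat-resp Φ) (sat-resp Ψ) b
        (PMChain⊆DownChain (reach⇒chain s)))

  bisimilar⇒ηEquivalent : ∀ {w₁ w₂} → WeaklyPMBisimilar F w₁ w₂ → ηEquivalent F w₁ w₂
  bisimilar⇒ηEquivalent (B , isBisim , b) Φ =
    mk⇔ (sat-resp isBisim Φ b)
        (sat-resp isBisim Φ (IsWeakPMBisimulation.symmetric isBisim b))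

  -- Characteristic formulas on finite models.

  ηEquivalent-sym : ∀ {x y} → ηEquivalent F x y → ηEquivalent F y x
  ηEquivalent-sym e Φ = ⇔-sym (e Φ)

  _∨_ : Formula PL → Formula PL → Formula PL
  Φ ∨ Ψ = neg (neg Φ ∧ neg Ψ)

  -- The grammar has no constant for truth, so one is built from a formula at hand; it serves as the
  -- empty conjunction.
  ⊤-from : Formula PL → Formula PL
  ⊤-from Φ = neg (Φ ∧ neg Φ)

  ⊤-from-sat : ∀ Φ {w} → Sat F w (⊤-from Φ)
  ⊤-from-sat Φ (s , ¬s) = ¬s s

  ⋀ : Formula PL → ∀ {n} → (Fin n → Formula PL) → Formula PL
  ⋀ Φ₀ {zero}  f = ⊤-from Φ₀
  ⋀ Φ₀ {suc n} f = f zero ∧ ⋀ Φ₀ (f ∘ suc)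

  ⋀-intro : ∀ Φ₀ {n w} (f : Fin n → Formula PL) → (∀ i → Sat F w (f i)) → Sat F w (⋀ Φ₀ f)
  ⋀-intro Φ₀ {zero}  f s = ⊤-from-sat Φ₀
  ⋀-intro Φ₀ {suc n} f s = s zero , ⋀-intro Φ₀ (f ∘ suc) (s ∘ suc)

  ⋀-elim : ∀ Φ₀ {n w} (f : Fin n → Formula PL) → Sat F w (⋀ Φ₀ f) → ∀ i → Sat F w (f i)
  ⋀-elim Φ₀ f (s , _) zero    = s
  ⋀-elim Φ₀ f (_ , t) (suc i) = ⋀-elim Φ₀ (f ∘ suc) t i

  module _ (em : ExcludedMiddle 0ℓ) where

    dne : DoubleNegationElimination 0ℓ
    dne = em⇒dne em

    ∨-elim : ∀ {w} Φ Ψ → Sat F w (Φ ∨ Ψ) → Sat F w Φ ⊎ Sat F w Ψ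
    ∨-elim Φ Ψ s = dne λ ¬either → s (¬either ∘ inj₁ , ¬either ∘ inj₂)

    separate : ∀ x y → ¬ ηEquivalent F x y → ∃ λ Φ → Sat F x Φ × ¬ Sat F y Φ
    separate x y x≢y = dne λ none → x≢y λ Φ → mk⇔
      (λ s → dne λ ¬t → none (Φ , s , ¬t))
      -- A formula true at `y` but false at `x` separates through its negation.
      (λ t → dne λ ¬s → none (neg Φ , ¬s , λ ¬t → ¬t t))

    module _ (finite : Finite W) (Φ₀ : Formula PL) where
      private
        enumerate = Inverse.from (proj₂ finite)
        index     = Inverse.to (proj₂ finite)

      -- Total in `y`, with truth as the default for equivalent points, so that a conjunction can
      -- range over all of `W`.
      separator : ∀ x y → ∃ λ Φ → Sat F x Φ × (Sat F y Φ → ηEquivalent F x y)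
      separator x y with em {ηEquivalent F x y}
      ... | yes x≡y = ⊤-from Φ₀ , ⊤-from-sat Φ₀ , λ _ → x≡y
      ... | no  x≢y = let Φ , s , ¬t = separate x y x≢y in Φ , s , ⊥-elim ∘ ¬t

      χ : W → Formula PL
      χ x = ⋀ Φ₀ (proj₁ ∘ separator x ∘ enumerate)

      χ-self : ∀ x → Sat F x (χ x)
      χ-self x = ⋀-intro Φ₀ _ (proj₁ ∘ proj₂ ∘ separator x ∘ enumerate)

      χ-defines : ∀ x → ⟦ χ x ⟧ ⊆ ηEquivalent F x
      χ-defines x {y} s =
        proj₂ (proj₂ (separator x y))
          -- The conjunct at `index y` separates `x` from `enumerate (index y)`, which equals `y`
          -- only propositionally.
          (subst (λ z → Sat F y (proj₁ (separator x z)))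
            (Inverse.strictlyInverseʳ (proj₂ finite) y) (⋀-elim Φ₀ _ s (index y)))

      ηEquivalent-transfer : ∀ {w₁ w₂} → ηEquivalent F w₁ w₂ →
                             ∀ u₁ d₁ → Comparable w₁ u₁ → d₁ ≼ u₁ →
                             PMReach (ηEquivalent F w₁ ∪ ηEquivalent F u₁) (ηEquivalent F d₁) w₂
      ηEquivalent-transfer {w₁} e u₁ d₁ w₁~u₁ d₁≼u₁ =
        let sat₁ = chain⇒reach {P = ⟦ χ w₁ ∨ χ u₁ ⟧} {Q = ⟦ χ d₁ ⟧}
              -- Repeating `w₁` gives the required upward first step by reflexivity, since `u₁` may
              -- lie below `w₁`.
              ( (λ s → proj₁ s (χ-self w₁)) , w₁ , ≼-refl
              , step (λ s → proj₁ s (χ-self w₁)) w₁~u₁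
                  (last (λ s → proj₂ s (χ-self u₁)) d₁≼u₁ (χ-self d₁)))
            k , π , isPath , q , ps = to (e (η (χ w₁ ∨ χ u₁) (χ d₁))) sat₁
        in  k , π , isPath , χ-defines d₁ q ,
            λ i → map (χ-defines w₁) (χ-defines u₁) (∨-elim (χ w₁) (χ u₁) (ps i))

    -- Without proposition letters there are no formulas at all, hence no χ.
    ηEquivalent-isBisimulation : Finite W → IsWeakPMBisimulation F (ηEquivalent F)
    ηEquivalent-isBisimulation finite = record
      { symmetric = ηEquivalent-sym
      ; atoms     = λ e p → e (atom p)
      ; transfer  = transfer
      }
      where
      transfer : ∀ {w₁ w₂} → ηEquivalent F w₁ w₂ →
                 ∀ u₁ d₁ → Comparable w₁ u₁ → d₁ ≼ u₁ →
                 PMReach (ηEquivalent F w₁ ∪ ηEquivalent F u₁) (ηEquivalent F d₁) w₂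
      transfer {w₁} {w₂} e u₁ d₁ w₁~u₁ d₁≼u₁ with em {Formula PL}
      ... | yes Φ₀        = ηEquivalent-transfer finite Φ₀ e u₁ d₁ w₁~u₁ d₁≼u₁
      ... | no  noFormula =
        -- All points are vacuously equivalent here, so the constant path at `w₂` of length 2
        -- suffices.
        chain⇒reach {P = ηEquivalent F w₁ ∪ ηEquivalent F u₁} {Q = ηEquivalent F d₁}
          (inj₁ e , w₂ , ≼-refl , last (inj₁ e) ≼-refl (⊥-elim ∘ noFormula))

theorem3 : ExcludedMiddle 0ℓ →
    (PL : Set) (F : PosetModel PL) → Finite (PosetModel.W F) →
    (w₁ w₂ : PosetModel.W F) →
    ηEquivalent F w₁ w₂ ⇔ WeaklyPMBisimilar F w₁ w₂
theorem3 em PL F finite w₁ w₂ =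
  mk⇔ (λ e → ηEquivalent F , ηEquivalent-isBisimulation F em finite , e)
      (bisimilar⇒ηEquivalent F)
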